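{- For all integers $\omega,\epsilon,p_1,p_2,n\ge 0$ there is a bijection $$\rho:\mathcal{U}(\omega,\epsilon,p_1,p_2,n)\to\mathcal{L}(\omega,\epsilon,p_1,p_2,n-2(\omega+2\epsilon)).$$ Moreover, $\rho$ sends each upper minimal segment with quadruple $(W,\omega,\epsilon,s)$ to a lower minimal segment with quadruple $(W,\omega,\epsilon,s-3)$.
   Context: A Schur partition is a partition of an integer into positive parts such that consecutive parts differ by at least $3$, and no two consecutive parts differing by exactly $3$ are both multiples of $3$. Upper pairs: in a Schur partition $\pi$, a part $x$ is in an upper pair if $x+3$ or $x-3$ is also a part, except when (i) $x$ is odd and is the largest element of an odd-length maximal arithmetic progression of parts of $\pi$ with common difference $3$, or (ii) $x$ is even and is the smallest element of such an odd-length maximal progression. A part not in an upper pair is an upper singleton. Lower pairs: a part $x>1$ is in a lower pair if $x+3$ or $x-3$ is also a part, except when (i) $x$ is even and is the largest element of an odd-length maximal arithmetic progression with common difference $3$ of parts greater than $1$, or (ii) $x$ is odd and is the smallest element of such a progression. A part not in a lower pair (including the part $1$) is a lower singleton. A primitive upper minimal segment is a Schur partition of one of the forms: (1) $o,o+4,\dots,o+4x,\ o+4x+5,o+4x+9,\dots,o+4(x+y)+5$ with $o>3$ odd and $x,y\ge0$; (2) $o,o+4,\dots,o+4x,\ p^*+3,p^*+6,\dots,p^*+3p,\ p^*+3p+4,\dots,p^*+3p+4y$, where $p^*=o+4x+1\not\equiv0\pmod 3$, $o>3$ odd, $x\ge0$, $y\ge1$, and $p\ge2$ even. Let $\mathcal{U}$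 be the smallest set of Schur partitions containing all primitive upper minimal segments and closed under: (Suffix rule) if $\Sigma\in\mathcal{U}$ has largest part $e$ even with $e\not\equiv0\pmod3$, then $\Sigma$ together with the parts $e+3,e+6,\dots,e+3p,\ e+3p+4,\dots,e+3p+4y$ ($p\ge2$ even, $y\ge1$) is in $\mathcal{U}$; (Prefix rule) if $\Sigma\in\mathcal{U}$ has smallest part $o=o'+4k+3(p+1)+1\not\equiv 0\pmod 3$ with $o'>3$ odd, $k\ge0$, $p\ge2$ even, then $\Sigma$ together with the parts $o',o'+4,\dots,o'+4k,\ o'+4k+4,o'+4k+7,\dots,o'+4k+3p+1$ is in $\mathcal{U}$. An upper minimal segment (here, as a partition in its own right) is an element of $\mathcal{U}$. Let $h$ subtract $3$ from every part. A lower minimal segment is a partition of the form $h(\Sigma)$ with $\Sigma\in\mathcal{U}$ whose smallest and largest parts are lower singletons. The S-codeword of an upper (resp. lower) minimal segment is the word obtained by listing its parts in increasing order and writing $S$ for each upper (resp. lower) singleton and $P$ for each part in an upper (resp. lower) pair. Its quadruple is $(W,\omega,\epsilon,s)$ where $W$ is the S-codeword, $\omega$ the number of odd parts, $\epsilon$ the number of even parts, and $s$ the smallest part. $\mathcal{U}(\omega,\epsilon,p_1,p_2,n)$ is the set of upper minimal segments with sum of parts $n$, $\omega$ odd parts, $\epsilon$ even parts, $p_1$ parts that are in upper pairs and are $\equiv1\pmod3$, and $p_2$ parts that are in upper pairs and are $\equiv 2\pmod 3$. $\mathcal{L}(\omega,\epsilon,p_1,p_2,n)$ is defined analogously for lower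 minimal segments with lower pairs. -}

module Defs where

open import Data.Nat using (ℕ; zero; suc; _+_; _*_; _∸_; _≤_; _<_; _%_; _≟_)
open import Data.Integer as ℤ using (ℤ)
open import Data.List using (List; []; _∷_; _++_; map; upTo; length; filter; head; last)
open import Data.Nat.ListAction using (sum)
open import Data.List.Membership.Propositional using (_∈_; _∉_)
open import Data.List.Relation.Unary.All using (All)
open import Data.List.Relation.Unary.Linked using (Linked)
open import Data.List.Relation.Binary.Pointwise using (Pointwise)
open import Data.Maybe using (Maybe; just)
open import Data.Product using (Σ; ∃; ∃-syntax; _×_; _,_)
open import Data.Sum using (_⊎_)
open import Data.Bool using (if_then_else_)
open import Relation.Binary.PropositionalEquality using (_≡_; _≢_)
open import Relation.Nullary using (¬_; does)

-- Partitions into distinct parts are represented by the list of their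
-- parts in strictly increasing order.

IsOdd IsEven : ℕ → Set
IsOdd x = x % 2 ≡ 1
IsEven x = x % 2 ≡ 0

SchurAdj : ℕ → ℕ → Set
SchurAdj x y = (x + 3 ≤ y) × (y ≡ x + 3 → ¬ (x % 3 ≡ 0 × y % 3 ≡ 0))

Schur : List ℕ → Set
Schur π = All (λ x → 0 < x) π × Linked SchurAdj π

module Progressions (Part : ℕ → Set) where

  LargestOfOddProg : ℕ → Set
  LargestOfOddProg x =
    Part x × ¬ Part (x + 3) ×
    ∃[ k ] ((∀ i → i ≤ 2 * k → ∃[ y ] (y + 3 * i ≡ x × Part y))
           × ¬ (∃[ y ] (y + 3 * (2 * k + 1) ≡ x × Part y)))

  SmallestOfOddProg : ℕ → Set
  SmallestOfOddProg x =
    Part x × ¬ (∃[ y ] (y + 3 ≡ x × Part y)) ×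
    ∃[ k ] ((∀ i → i ≤ 2 * k → Part (x + 3 * i))
           × ¬ Part (x + 3 * (2 * k + 1)))

  HasNeighbour : ℕ → Set
  HasNeighbour x = Part (x + 3) ⊎ ∃[ y ] (y + 3 ≡ x × Part y)

open Progressions

InUpperPair : List ℕ → ℕ → Set
InUpperPair π x =
  x ∈ π × HasNeighbour P x
  × ¬ (IsOdd x × LargestOfOddProg P x)
  × ¬ (IsEven x × SmallestOfOddProg P x)
  where P = λ y → y ∈ π

InLowerPair : List ℕ → ℕ → Set
InLowerPair π x =
  1 < x × x ∈ π × HasNeighbour P x
  × ¬ (IsEven x × LargestOfOddProg P x)
  × ¬ (IsOdd x × SmallestOfOddProg P x)
  where P = λ y → y ∈ π × 1 < y

data Letter : Set where
  S P : Letter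

LetterOf : (ℕ → Set) → ℕ → Letter → Set
LetterOf InPair x c = (c ≡ P × InPair x) ⊎ (c ≡ S × ¬ InPair x)

UpperCodeword LowerCodeword : List ℕ → List Letter → Set
UpperCodeword π W = Pointwise (LetterOf (InUpperPair π)) π W
LowerCodeword π W = Pointwise (LetterOf (InLowerPair π)) π W

pairCount : ℕ → List ℕ → List Letter → ℕ
pairCount r (x ∷ xs) (P ∷ W) = (if does (x % 3 ≟ r) then 1 else 0) + pairCount r xs W
pairCount r (x ∷ xs) (S ∷ W) = pairCount r xs W
pairCount r _ _ = 0

numOdd numEven : List ℕ → ℕ
numOdd π = length (filter (λ x → x % 2 ≟ 1) π)
numEven π = length (filter (λ x → x % 2 ≟ 0) π)

prog : ℕ → ℕ → ℕ → List ℕ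
prog a d m = map (λ i → a + d * i) (upTo m)

data UpperMinSeg : List ℕ → Set where
  prim₁ : ∀ o x y → IsOdd o → 3 < o →
          let π = prog o 4 (suc x) ++ prog (o + 4 * x + 5) 4 (suc y) in
          Schur π → UpperMinSeg π
  prim₂ : ∀ o x p y → IsOdd o → 3 < o → 1 ≤ y → 2 ≤ p → IsEven p →
          let p* = o + 4 * x + 1
              π  = prog o 4 (suc x) ++ prog (p* + 3) 3 p ++ prog (p* + 3 * p + 4) 4 y in
          p* % 3 ≢ 0 → Schur π → UpperMinSeg π
  suffix : ∀ Σ' e p y → UpperMinSeg Σ' → last Σ' ≡ just e → IsEven e → e % 3 ≢ 0 →
           2 ≤ p → IsEven p → 1 ≤ y →
           let π = Σ' ++ prog (e + 3) 3 p ++ prog (e + 3 * p + 4) 4 y in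
           Schur π → UpperMinSeg π
  prefix : ∀ Σ' o o' k p → UpperMinSeg Σ' → head Σ' ≡ just o →
           o ≡ o' + 4 * k + 3 * (p + 1) + 1 → o % 3 ≢ 0 →
           IsOdd o' → 3 < o' → 2 ≤ p → IsEven p →
           let π = prog o' 4 (suc k) ++ prog (o' + 4 * k + 4) 3 p ++ Σ' in
           Schur π → UpperMinSeg π

h : List ℕ → List ℕ
h = map (λ x → x ∸ 3)

LowerMinSeg : List ℕ → Set
LowerMinSeg λ' =
  ∃[ Σ' ] (UpperMinSeg Σ' × λ' ≡ h Σ'
          × ∃[ a ] ∃[ b ] (head λ' ≡ just a × last λ' ≡ just b
                           × ¬ InLowerPair λ' a × ¬ InLowerPair λ' b))

𝒰 : ℕ → ℕ → ℕ → ℕ → ℕ → List ℕ → Set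
𝒰 ω ε p₁ p₂ n π =
  UpperMinSeg π × sum π ≡ n × numOdd π ≡ ω × numEven π ≡ ε
  × ∃[ W ] (UpperCodeword π W × pairCount 1 π W ≡ p₁ × pairCount 2 π W ≡ p₂)

ℒ : ℕ → ℕ → ℕ → ℕ → ℤ → List ℕ → Set
ℒ ω ε p₁ p₂ n λ' =
  LowerMinSeg λ' × ℤ.+ (sum λ') ≡ n × numOdd λ' ≡ ω × numEven λ' ≡ ε
  × ∃[ W ] (LowerCodeword λ' W × pairCount 1 λ' W ≡ p₁ × pairCount 2 λ' W ≡ p₂)

{-# OPTIONS --safe #-}
-- Minimal segments are parametrised by (s, a, c), where c is the S-codeword with
-- adjacent P's grouped into pairs (an odd part x and x + 3) and a is the number of
-- odd singletons.  The part with n singletons and m paired parts before it is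
-- s + 4n + 3m, increased by 1 when it is an even singleton: the gap 5 of the first
-- kind of primitive segment, and the gaps 3, …, 3, 4 around a block of pairs to the
-- right of the centre, are all accounted for by this increment.  Hence the
-- positions of the paired parts do not depend on a, and neither does the condition
-- that none of them is divisible by 3.  The map ρ exchanges the numbers of odd
-- and even singletons and then applies h, which exchanges parities back.
module Submission where

open import Defs
open import Data.Nat as ℕ using (ℕ; zero; suc; _+_; _*_; _∸_; _≤_; _<_; _%_; _≟_; z≤n; s≤s; z<s)
open import Data.Nat.Properties
open import Data.Nat.Divisibility using (divides; m%n≡0⇒n∣m)
open import Data.Nat.DivMod using (m*n%n≡0)
open import Data.Nat.Tactic.RingSolver using (solve-∀)
open import Data.Nat.ListAction using (sum)
open import Data.Integer as ℤ using (ℤ)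
import Data.Integer.Properties as ℤ
open import Data.List
  using (List; []; _∷_; _++_; _∷ʳ_; head; last; map; replicate; length; filter; upTo; applyUpTo)
open import Data.List.Properties
  using (++-assoc; ++-identityʳ; filter-accept; filter-reject; map-upTo; map-∘; map-cong; map-++; upTo-∷ʳ)
open import Data.List.Membership.Propositional using (_∈_; _∉_)
open import Data.List.Relation.Unary.Any using (here; there)
open import Data.List.Relation.Unary.All as All using (All; []; _∷_)
open import Data.List.Relation.Unary.All.Properties using (++⁻ˡ)
open import Data.List.Relation.Unary.Linked as Linked using (Linked; []; [-]; _∷_)
open import Data.List.Relation.Binary.Pointwise as Pointwise using (Pointwise; []; _∷_)
open import Data.Maybe as Maybe using (Maybe; just; fromMaybe)
open import Data.Maybe.Properties using (just-injective)
open import Data.Product using (Σ; ∃-syntax; _×_; _,_; proj₁; proj₂)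
open import Data.Sum using (_⊎_; inj₁; inj₂)
open import Data.Bool using (if_then_else_)
open import Data.Unit using (⊤)
open import Data.Empty using (⊥-elim)
open import Function using (_∘_; case_of_)
open import Relation.Nullary using (¬_; does)
open import Relation.Nullary.Decidable using (_×-dec_; dec-true; dec-false)
open import Relation.Binary.PropositionalEquality

-- Token lists and the partitions they encode

data Token : Set where
  single pair : Token

-- The second argument counts the remaining singletons of the parity of v; the base v
-- is odd for upper segments and even for lower ones.
build : ℕ → ℕ → List Token → List ℕ
build v a       []           = []
build v a       (pair ∷ c)   = v ∷ 3 + v ∷ build (6 + v) a c
build v zero    (single ∷ c) = suc v ∷ build (4 + v) zero c
build v (suc a) (single ∷ c) = v ∷ build (4 + v) a c

word : List Token → List Letter
word []           = []
word (single ∷ c) = S ∷ word c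
word (pair ∷ c)   = P ∷ P ∷ word c

end : ℕ → List Token → ℕ
end v []           = v
end v (single ∷ c) = end (4 + v) c
end v (pair ∷ c)   = end (6 + v) c

singles pairs : List Token → ℕ
singles []           = 0
singles (single ∷ c) = suc (singles c)
singles (pair ∷ c)   = singles c
pairs []           = 0
pairs (single ∷ c) = pairs c
pairs (pair ∷ c)   = suc (pairs c)

-- Paired parts sit in progressions of step 3, where the Schur condition rules out multiples of 3;
-- `v` and `3 + v` share their residue, so one test covers a pair.
Valid : ℕ → List Token → Set
Valid v []           = ⊤
Valid v (single ∷ c) = Valid (4 + v) c
Valid v (pair ∷ c)   = v % 3 ≢ 0 × Valid (6 + v) c

odd⇒suc-even : ∀ v → v % 2 ≡ 1 → suc v % 2 ≡ 0
odd⇒suc-even (suc zero)    _  = refl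
odd⇒suc-even (suc (suc v)) eq = odd⇒suc-even v eq

even⇒suc-odd : ∀ v → v % 2 ≡ 0 → suc v % 2 ≡ 1
even⇒suc-odd zero          _  = refl
even⇒suc-odd (suc (suc v)) eq = even⇒suc-odd v eq

suc-odd⇒even : ∀ v → suc v % 2 ≡ 1 → v % 2 ≡ 0
suc-odd⇒even zero          _  = refl
suc-odd⇒even (suc (suc v)) eq = suc-odd⇒even v eq

-- Every part on the left is definitionally of the form `3 + x`, so the subtraction in `h` computes
-- without truncation.
h-build : ∀ v a c → h (build (3 + v) a c) ≡ build v a c
h-build v a       []           = refl
h-build v zero    (single ∷ c) = cong (suc v ∷_) (h-build (4 + v) zero c)
h-build v (suc a) (single ∷ c) = cong (v ∷_) (h-build (4 + v) a c)
h-build v a       (pair ∷ c)   = cong (λ l → v ∷ 3 + v ∷ l) (h-build (6 + v) a c)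

∈-build⇒≥ : ∀ v a c {y} → y ∈ build v a c → v ≤ y
∈-build⇒≥ v zero    (single ∷ c) (here refl)         = n≤1+n v
∈-build⇒≥ v zero    (single ∷ c) (there m)           = m+n≤o⇒n≤o 4 (∈-build⇒≥ (4 + v) zero c m)
∈-build⇒≥ v (suc a) (single ∷ c) (here refl)         = ≤-refl
∈-build⇒≥ v (suc a) (single ∷ c) (there m)           = m+n≤o⇒n≤o 4 (∈-build⇒≥ (4 + v) a c m)
∈-build⇒≥ v a       (pair ∷ c)   (here refl)         = ≤-refl
∈-build⇒≥ v a       (pair ∷ c)   (there (here refl)) = m≤n+m v 3
∈-build⇒≥ v a       (pair ∷ c)   (there (there m))   = m+n≤o⇒n≤o 6 (∈-build⇒≥ (6 + v) a c m)

-- Sums and counts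

module Count (r : ℕ) where
  count : List ℕ → ℕ
  count l = length (filter (λ x → x % 2 ≟ r) l)

  count-yes : ∀ x l → x % 2 ≡ r → count (x ∷ l) ≡ suc (count l)
  count-yes x l eq = cong length (filter-accept (λ x → x % 2 ≟ r) {x} {l} eq)

  count-no : ∀ x l → x % 2 ≢ r → count (x ∷ l) ≡ count l
  count-no x l ne = cong length (filter-reject (λ x → x % 2 ≟ r) {x} {l} ne)

  -- Each pair contributes one part of either parity. The base moves by 4 or 6 and `_% 2` computes,
  -- so both parity hypotheses pass to the tail unchanged.
  count-first : ∀ v a b c → v % 2 ≡ r → suc v % 2 ≢ r → a + b ≡ singles c →
                count (build v a c) ≡ a + pairs c
  count-first v zero    b []           p q eq = refl
  count-first v zero    (suc b) (single ∷ c) p q eq =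
    trans (count-no (suc v) _ q) (count-first (4 + v) zero b c p q (suc-injective eq))
  count-first v (suc a) b (single ∷ c) p q eq =
    trans (count-yes v _ p) (cong suc (count-first (4 + v) a b c p q (suc-injective eq)))
  count-first v a       b (pair ∷ c)   p q eq =
    trans (count-yes v _ p) (trans (cong suc (trans (count-no (3 + v) _ q) (count-first (6 + v) a b c p q eq)))
      (sym (+-suc a (pairs c))))

  count-second : ∀ v a b c → v % 2 ≢ r → suc v % 2 ≡ r → a + b ≡ singles c →
                 count (build v a c) ≡ b + pairs c
  count-second v zero    zero    []           p q eq = refl
  count-second v zero    (suc b) (single ∷ c) p q eq =
    trans (count-yes (suc v) _ q) (cong suc (count-second (4 + v) zero b c p q (suc-injective eq)))
  count-second v (suc a) b (single ∷ c) p q eq =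
    trans (count-no v _ p) (count-second (4 + v) a b c p q (suc-injective eq))
  count-second v a       b (pair ∷ c)   p q eq =
    trans (count-no v _ p) (trans (count-yes (3 + v) _ q) (trans (cong suc (count-second (6 + v) a b c p q eq))
      (sym (+-suc b (pairs c)))))

numOdd-build : ∀ v a b c → v % 2 ≡ 1 → a + b ≡ singles c → numOdd (build v a c) ≡ a + pairs c
numOdd-build v a b c odd =
  Count.count-first 1 v a b c odd (λ e → case trans (sym (odd⇒suc-even v odd)) e of λ ())

numEven-build : ∀ v a b c → v % 2 ≡ 1 → a + b ≡ singles c → numEven (build v a c) ≡ b + pairs c
numEven-build v a b c odd =
  Count.count-second 0 v a b c (λ e → case trans (sym odd) e of λ ()) (odd⇒suc-even v odd)

numOdd-build′ : ∀ v a b c → v % 2 ≡ 0 → b + a ≡ singles c → numOdd (build v b c) ≡ a + pairs c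
numOdd-build′ v a b c even =
  Count.count-second 1 v b a c (λ e → case trans (sym even) e of λ ()) (even⇒suc-odd v even)

numEven-build′ : ∀ v a b c → v % 2 ≡ 0 → b + a ≡ singles c → numEven (build v b c) ≡ b + pairs c
numEven-build′ v a b c even =
  Count.count-first 0 v b a c even (λ e → case trans (sym (even⇒suc-odd v even)) e of λ ())

-- The sum of build v 0 c, in which every singleton carries the increment 1.
evenTotal : ℕ → List Token → ℕ
evenTotal v []           = 0
evenTotal v (single ∷ c) = suc v + evenTotal (4 + v) c
evenTotal v (pair ∷ c)   = v + (3 + v + evenTotal (6 + v) c)

-- Each of the `a` singletons without increment falls one short of its value in `evenTotal`.
sum-build : ∀ v a c → a ≤ singles c → sum (build v a c) + a ≡ evenTotal v c
sum-build v zero    []           _       = refl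
sum-build v zero    (single ∷ c) _       =
  trans (+-assoc (suc v) (sum (build (4 + v) 0 c)) 0) (cong (suc v +_) (sum-build (4 + v) 0 c z≤n))
sum-build v (suc a) (single ∷ c) (s≤s p) =
  trans (lem v (sum (build (4 + v) a c)) a) (cong (suc v +_) (sum-build (4 + v) a c p))
  where
  lem : ∀ v s a → v + s + suc a ≡ suc v + (s + a)
  lem = solve-∀
sum-build v a       (pair ∷ c)   p       =
  trans (lem v (sum (build (6 + v) a c)) a) (cong (λ t → v + (3 + v + t)) (sum-build (6 + v) a c p))
  where
  lem : ∀ v s a → v + (3 + v + s) + a ≡ v + (3 + v + (s + a))
  lem = solve-∀

evenTotal-shift : ∀ v c → evenTotal (3 + v) c ≡ evenTotal v c + 3 * (singles c + 2 * pairs c)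
evenTotal-shift v []           = refl
evenTotal-shift v (single ∷ c) =
  trans (cong (4 + v +_) (evenTotal-shift (4 + v) c)) (lem v (evenTotal (4 + v) c) (singles c) (pairs c))
  where
  lem : ∀ v t n p → 4 + v + (t + 3 * (n + 2 * p)) ≡ suc v + t + 3 * (suc n + 2 * p)
  lem = solve-∀
evenTotal-shift v (pair ∷ c)   =
  trans (cong (λ t → 3 + v + (6 + v + t)) (evenTotal-shift (6 + v) c)) (lem v (evenTotal (6 + v) c) (singles c) (pairs c))
  where
  lem : ∀ v t n p → 3 + v + (6 + v + (t + 3 * (n + 2 * p))) ≡ v + (3 + v + t) + 3 * (n + 2 * suc p)
  lem = solve-∀

-- Both sums are measured against `evenTotal`. With p pairs the difference is 3(a + b + 2p) + b - a
-- = 2((a + p) + 2(b + p)), where a + p and b + p are the numbers of odd and even parts when `3 + v`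
-- is odd.
sum-build-swap : ∀ v a b c → a + b ≡ singles c →
  sum (build (3 + v) a c) ≡ sum (build v b c) + 2 * ((a + pairs c) + 2 * (b + pairs c))
sum-build-swap v a b c eq = +-cancelʳ-≡ a _ _ (begin
  sum (build (3 + v) a c) + a                                        ≡⟨ sum-build (3 + v) a c (m+n≤o⇒m≤o a (≤-reflexive eq)) ⟩
  evenTotal (3 + v) c                                                ≡⟨ evenTotal-shift v c ⟩
  evenTotal v c + 3 * (singles c + 2 * pairs c)                      
    ≡⟨ cong₂ (λ t n → t + 3 * (n + 2 * pairs c)) (sum-build v b c (m+n≤o⇒n≤o a (≤-reflexive eq))) eq ⟨
  sum (build v b c) + b + 3 * (a + b + 2 * pairs c)                  ≡⟨ lem (sum (build v b c)) a b (pairs c) ⟩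
  sum (build v b c) + 2 * ((a + pairs c) + 2 * (b + pairs c)) + a    ∎)
  where
  open ≡-Reasoning
  lem : ∀ s a b p → s + b + 3 * (a + b + 2 * p) ≡ s + 2 * ((a + p) + 2 * (b + p)) + a
  lem = solve-∀

pairCount-build : ∀ r v a b c →
  pairCount r (build (3 + v) a c) (word c) ≡ pairCount r (build v b c) (word c)
pairCount-build r v a       b       []           = refl
pairCount-build r v zero    zero    (single ∷ c) = pairCount-build r (4 + v) 0 0 c
pairCount-build r v zero    (suc b) (single ∷ c) = pairCount-build r (4 + v) 0 b c
pairCount-build r v (suc a) zero    (single ∷ c) = pairCount-build r (4 + v) a 0 c
pairCount-build r v (suc a) (suc b) (single ∷ c) = pairCount-build r (4 + v) a b c
pairCount-build r v a       b       (pair ∷ c)   =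
  cong (λ n → i + (i + n)) (pairCount-build r (6 + v) a b c)
  where i = if does (v % 3 ≟ r) then 1 else 0

-- Codewords

-- Upper and lower pairs are treated at once: `lo` is the residue whose largest elements are
-- exceptional, `hi` the one whose smallest elements are.
module Codeword (Part : ℕ → Set) (lo hi : ℕ) (lo≢hi : lo ≢ hi) where
  open Progressions Part

  Paired : ℕ → Set
  Paired x = HasNeighbour x × ¬ (x % 2 ≡ lo × LargestOfOddProg x) × ¬ (x % 2 ≡ hi × SmallestOfOddProg x)

  PairedLetter : ℕ → Letter → Set
  PairedLetter x c = (c ≡ P × Part x × Paired x) ⊎ (c ≡ S × ¬ Paired x)

  -- The induction consumes the list while `Part` stays global; parts already passed are recorded
  -- only as lying at least 3 below the base.
  Window : ℕ → List ℕ → Set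
  Window v l = (∀ {y} → y ∈ l → Part y) × (∀ {y} → Part y → y + 3 ≤ v ⊎ y ∈ l)

  Window-tail : ∀ {v v′ x l} → v ≤ v′ → x + 3 ≤ v′ → Window v (x ∷ l) → Window v′ l
  Window-tail {v} {v′} {x} {l} v≤v′ x≤ (to , from) = to ∘ there , from′
    where
    from′ : ∀ {y} → Part y → y + 3 ≤ v′ ⊎ y ∈ l
    from′ p with from p
    ... | inj₁ y≤          = inj₁ (≤-trans y≤ v≤v′)
    ... | inj₂ (here refl) = inj₁ x≤
    ... | inj₂ (there m)   = inj₂ m

  Window-single-first : ∀ {v a c} → Window v (build v (suc a) (single ∷ c)) → Window (4 + v) (build (4 + v) a c)
  Window-single-first {v} = Window-tail (m≤n+m v 4) (≤-trans (≤-reflexive (+-comm v 3)) (n≤1+n _))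

  Window-single-second : ∀ {v c} → Window v (build v 0 (single ∷ c)) → Window (4 + v) (build (4 + v) 0 c)
  Window-single-second {v} = Window-tail (m≤n+m v 4) (≤-reflexive (+-comm (suc v) 3))

  Window-pair : ∀ {v a c} → Window v (build v a (pair ∷ c)) → Window (6 + v) (build (6 + v) a c)
  Window-pair {v} = Window-tail {3 + v} (m≤n+m (3 + v) 3) (≤-reflexive (+-comm (3 + v) 3))
                  ∘ Window-tail {v} (m≤n+m v 3) (≤-reflexive (+-comm v 3))

  ∉-build : ∀ {v y} a c → y < v → y ∉ build v a c
  ∉-build a c y<v m = <⇒≱ y<v (∈-build⇒≥ _ a c m)

  -- Progressions of even length that end just before v, or start just after x.
  RunBefore RunAfter : ℕ → Set
  RunBefore v = ∃[ k ] ((∀ i → i < k * 2 → ∃[ y ] (y + 3 * suc i ≡ v × Part y))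
                       × ¬ (∃[ y ] (y + 3 * (2 * k + 1) ≡ v × Part y)))
  RunAfter x = ∃[ k ] ((∀ i → i < k * 2 → Part (x + 3 * suc i)) × ¬ Part (x + 3 * (2 * k + 1)))

  -- Index 0 is `x` itself, which turns the even run before it into a progression of odd length.
  runBefore⇒largest : ∀ {x} → Part x → ¬ Part (x + 3) → RunBefore x → LargestOfOddProg x
  runBefore⇒largest {x} p np (k , f , g) = p , np , k , f′ , g
    where
    f′ : ∀ i → i ≤ 2 * k → ∃[ y ] (y + 3 * i ≡ x × Part y)
    f′ zero    _  = x , +-identityʳ x , p
    f′ (suc i) i< = f i (≤-trans i< (≤-reflexive (*-comm 2 k)))

  runAfter⇒smallest : ∀ {x} → Part x → ¬ (∃[ y ] (y + 3 ≡ x × Part y)) → RunAfter x → SmallestOfOddProg x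
  runAfter⇒smallest {x} p np (k , f , g) = p , np , k , f′ , g
    where
    f′ : ∀ i → i ≤ 2 * k → Part (x + 3 * i)
    f′ zero    _  = subst Part (sym (+-identityʳ x)) p
    f′ (suc i) i< = f i (≤-trans i< (≤-reflexive (*-comm 2 k)))

  runBefore-empty : ∀ {v} → ¬ (∃[ y ] (y + 3 ≡ v × Part y)) → RunBefore v
  runBefore-empty np = 0 , (λ _ ()) , np

  runBefore-pair : ∀ {v} → Part v → Part (3 + v) → RunBefore v → RunBefore (6 + v)
  runBefore-pair {v} p p′ (k , f , g) = suc k , f′ , g′
    where
    f′ : ∀ i → i < suc k * 2 → ∃[ y ] (y + 3 * suc i ≡ 6 + v × Part y)
    f′ 0             _              = 3 + v , +-comm (3 + v) 3 , p′
    f′ 1             _              = v , +-comm v 6 , p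
    -- The bound is written `k * 2` because `suc k * 2` unfolds by two successors, leaving the
    -- indices of the shorter run.
    f′ (suc (suc i)) (s≤s (s≤s i<)) = let y , e , py = f i i< in y , trans (lem y i) (cong (6 +_) e) , py
      where
      lem : ∀ y i → y + 3 * (3 + i) ≡ 6 + (y + 3 * suc i)
      lem = solve-∀
    g′ : ¬ (∃[ y ] (y + 3 * (2 * suc k + 1) ≡ 6 + v × Part y))
    g′ (y , e , py) = g (y , +-cancelˡ-≡ 6 _ _ (trans (lem y k) e) , py)
      where
      lem : ∀ y k → 6 + (y + 3 * (2 * k + 1)) ≡ y + 3 * (2 * suc k + 1)
      lem = solve-∀

  -- Without singletons of the base parity, whatever follows `x` in steps of 3 consists of whole
  -- pairs, hence has even length; the next singleton lies one above the base and ends the run.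
  runAfter : ∀ x c → Window (3 + x) (build (3 + x) 0 c) → RunAfter x
  runAfter x [] (_ , from) = 0 , (λ _ ()) , λ p → case from p of λ where
    (inj₁ le) → <⇒≱ (m<m+n (x + 3) z<s) (≤-trans le (≤-reflexive (+-comm 3 x)))
  runAfter x (single ∷ c) (_ , from) = 0 , (λ _ ()) , λ p → case from p of λ where
    (inj₁ le)        → <⇒≱ (m<m+n (x + 3) z<s) (≤-trans le (≤-reflexive (+-comm 3 x)))
    (inj₂ (here e))  → 1+n≢n (trans (sym e) (+-comm x 3))
    (inj₂ (there m)) → ∉-build 0 c (s≤s (≤-trans (≤-reflexive (+-comm x 3)) (m≤n+m (3 + x) 3))) m
  runAfter x (pair ∷ c) w@(to , _) with runAfter (6 + x) c (Window-pair w)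
  ... | k , f , g = suc k , f′ , λ p → g (subst Part (lem′ x k) p)
    where
    lem : ∀ x i → 6 + x + 3 * suc i ≡ x + 3 * (3 + i)
    lem = solve-∀
    lem′ : ∀ x k → x + 3 * (2 * suc k + 1) ≡ 6 + x + 3 * (2 * k + 1)
    lem′ = solve-∀
    f′ : ∀ i → i < suc k * 2 → Part (x + 3 * suc i)
    f′ 0             _              = subst Part (+-comm 3 x) (to (here refl))
    f′ 1             _              = subst Part (+-comm 6 x) (to (there (here refl)))
    f′ (suc (suc i)) (s≤s (s≤s i<)) = subst Part (lem x i) (f i i<)

  -- A singleton of the base parity closes a progression: an even run precedes it and the next part
  -- is at least 4 away. One of the other parity opens a progression, by `runAfter`. In a pair, the
  -- partner excludes one exception and the parity excludes the other. The premise on `RunBefore` is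
  -- conditional because it fails right after a singleton of the other parity, when `a` is 0.
  codeword : ∀ v a c → v % 2 ≡ lo → suc v % 2 ≡ hi → Window v (build v a c) → (0 < a → RunBefore v) →
             Pointwise PairedLetter (build v a c) (word c)
  codeword v a [] _ _ _ _ = []
  codeword v zero (single ∷ c) p q w@(to , from) _ =
    inj₂ (refl , λ (_ , _ , ns) → ns (q ,
      runAfter⇒smallest (to (here refl)) no-before (runAfter (suc v) c (Window-single-second w))))
    ∷ codeword (4 + v) 0 c p q (Window-single-second w) (λ ())
    where
    no-before : ¬ (∃[ y ] (y + 3 ≡ suc v × Part y))
    no-before (y , e , py) with from py
    ... | inj₁ le = 1+n≰n (subst (_≤ v) e le)
    ... | inj₂ m  = <⇒≱ (≤-trans (m<m+n y {2} z<s) (≤-reflexive (suc-injective (trans (sym (+-suc y 2)) e))))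
                      (∈-build⇒≥ v 0 (single ∷ c) m)
  codeword v (suc a) (single ∷ c) p q w@(to , from) run =
    inj₂ (refl , λ (_ , nl , _) → nl (p , runBefore⇒largest (to (here refl)) no-after (run z<s)))
    ∷ codeword (4 + v) a c p q (Window-single-first {a = a} w) (λ _ → runBefore-empty no-before)
    where
    no-after : ¬ Part (v + 3)
    no-after pv with from pv
    ... | inj₁ le        = <⇒≱ (≤-trans (m<m+n v {3} z<s) (m≤m+n (v + 3) 3)) le
    ... | inj₂ (here e)  = <⇒≢ (m<m+n v {3} z<s) (sym e)
    ... | inj₂ (there m) = ∉-build a c (s≤s (≤-reflexive (+-comm v 3))) m
    -- The only candidate is `suc v`, which lies strictly between `v` and the rest of the list.
    no-before : ¬ (∃[ y ] (y + 3 ≡ 4 + v × Part y))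
    no-before (y , e , py) with +-cancelʳ-≡ 3 y (suc v) (trans e (+-comm 3 (suc v)))
    ... | refl with from py
    ...   | inj₁ le        = <⇒≱ (m≤m+n (suc v) 3) le
    ...   | inj₂ (here e)  = 1+n≢n e
    ...   | inj₂ (there m) = ∉-build a c (m≤n+m (2 + v) 2) m
  codeword v a (pair ∷ c) p q w@(to , from) run =
    inj₁ (refl , pv , inj₁ pv+3 , (λ (_ , _ , n , _) → n pv+3) , λ (e , _) → lo≢hi (trans (sym p) e))
    ∷ inj₁ (refl , pv′ , inj₂ (v , +-comm v 3 , pv) , (λ (e , _) → lo≢hi (trans (sym e) q)) ,
            λ (_ , _ , n , _) → n (v , +-comm v 3 , pv))
    ∷ codeword (6 + v) a c p q (Window-pair {a = a} w) (λ a>0 → runBefore-pair pv pv′ (run a>0))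
    where
    pv = to (here refl)
    pv′ = to (there (here refl))
    pv+3 = subst Part (+-comm 3 v) pv′

  codeword-start : ∀ v a c → v % 2 ≡ lo → suc v % 2 ≡ hi →
    (∀ {y} → y ∈ build v a c → Part y) → (∀ {y} → Part y → y ∈ build v a c) →
    Pointwise PairedLetter (build v a c) (word c)
  codeword-start v a c p q to from = codeword v a c p q (to , inj₂ ∘ from)
    λ _ → runBefore-empty λ (y , e , py) →
      <⇒≱ (≤-trans (m<m+n y {3} z<s) (≤-reflexive e)) (∈-build⇒≥ v a c (from py))

upperCodeword-build : ∀ v a c → v % 2 ≡ 1 → UpperCodeword (build v a c) (word c)
upperCodeword-build v a c odd = Pointwise.map conv (codeword-start v a c odd (odd⇒suc-even v odd) (λ m → m) (λ m → m))
  where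
  open Codeword (_∈ build v a c) 1 0 (λ ())
  conv : ∀ {x l} → PairedLetter x l → LetterOf (InUpperPair (build v a c)) x l
  conv (inj₁ (e , pr))   = inj₁ (e , pr)
  conv (inj₂ (e , npr)) = inj₂ (e , npr ∘ proj₂)

lowerCodeword-build : ∀ v a c → v % 2 ≡ 0 → 1 < v → LowerCodeword (build v a c) (word c)
lowerCodeword-build v a c even 1<v = Pointwise.map conv
  (codeword-start v a c even (even⇒suc-odd v even) (λ m → m , <-≤-trans 1<v (∈-build⇒≥ v a c m)) proj₁)
  where
  open Codeword (λ y → y ∈ build v a c × 1 < y) 0 1 (λ ())
  conv : ∀ {x l} → PairedLetter x l → LetterOf (InLowerPair (build v a c)) x l
  conv (inj₁ (e , (m , 1<x) , pr)) = inj₁ (e , 1<x , m , pr)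
  conv (inj₂ (e , npr))           = inj₂ (e , λ (_ , _ , pr) → npr pr)

letter-unique : ∀ {Q : ℕ → Set} {x c d} → LetterOf Q x c → LetterOf Q x d → c ≡ d
letter-unique (inj₁ (refl , q)) (inj₁ (refl , _)) = refl
letter-unique (inj₁ (_ , q))    (inj₂ (_ , nq))   = ⊥-elim (nq q)
letter-unique (inj₂ (_ , nq))   (inj₁ (_ , q))    = ⊥-elim (nq q)
letter-unique (inj₂ (refl , _)) (inj₂ (refl , _)) = refl

-- The two alternatives of `LetterOf` exclude each other. This identifies the codeword inside the
-- existential of `𝒰` or `ℒ` with `word c`.
word-unique : ∀ {Q xs V W} → Pointwise (LetterOf Q) xs V → Pointwise (LetterOf Q) xs W → V ≡ W
word-unique []       []         = refl
word-unique {Q} (l ∷ ls) (l′ ∷ ls′) = cong₂ _∷_ (letter-unique {Q} l l′) (word-unique ls ls′)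

-- Decoding

-- A part of the first parity class (residue r modulo 2) is paired exactly when it
-- is followed by a part exceeding it by 3.
decode : ℕ → List ℕ → List Token
decode r []          = []
decode r (x ∷ [])    = single ∷ []
decode r (x ∷ y ∷ l) =
  if does (x % 2 ≟ r ×-dec y ≟ 3 + x) then pair ∷ decode r l else single ∷ decode r (y ∷ l)

decode-single : ∀ r x l → (x % 2 ≡ r → 3 + x ∉ l) → decode r (x ∷ l) ≡ single ∷ decode r l
decode-single r x []      n = refl
decode-single r x (y ∷ l) n
  rewrite dec-false (x % 2 ≟ r ×-dec y ≟ 3 + x) (λ (p , e) → n p (here (sym e))) = refl

decode-pair : ∀ r x l → x % 2 ≡ r → decode r (x ∷ 3 + x ∷ l) ≡ pair ∷ decode r l
decode-pair r x l p rewrite dec-true (x % 2 ≟ r ×-dec 3 + x ≟ 3 + x) (p , refl) = refl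

decode-build : ∀ r v a c → v % 2 ≡ r → suc v % 2 ≢ r → decode r (build v a c) ≡ c
decode-build r v a       []           p q = refl
decode-build r v a       (pair ∷ c)   p q =
  trans (decode-pair r v (build (6 + v) a c) p) (cong (pair ∷_) (decode-build r (6 + v) a c p q))
-- The part `suc v` can be followed by a pair starting exactly 3 higher; only the residue test tells
-- it from the first part of a pair.
decode-build r v zero    (single ∷ c) p q =
  trans (decode-single r (suc v) (build (4 + v) 0 c) (⊥-elim ∘ q))
    (cong (single ∷_) (decode-build r (4 + v) 0 c p q))
decode-build r v (suc a) (single ∷ c) p q =
  trans (decode-single r v (build (4 + v) a c) λ _ m → <-irrefl refl (∈-build⇒≥ (4 + v) a c m))
    (cong (single ∷_) (decode-build r (4 + v) a c p q))

-- Shapes of token lists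

-- The runs are the blocks from which the constructors of `UpperMinSeg` assemble a segment, except
-- that the two progressions of `prim₁` share one run of singles.
data Shape : List Token → Set where
  last-run : ∀ k → Shape (replicate (suc k) single)
  run      : ∀ k m {c} → Shape c → Shape (replicate (suc k) single ++ replicate (suc m) pair ++ c)

replicate-+ : ∀ {A : Set} m n (x : A) → replicate (m + n) x ≡ replicate m x ++ replicate n x
replicate-+ zero    n x = refl
replicate-+ (suc m) n x = cong (x ∷_) (replicate-+ m n x)

Shape-head : ∀ {c} → Shape c → ∃[ d ] c ≡ single ∷ d
Shape-head (last-run k) = _ , refl
Shape-head (run k m sh) = _ , refl

Shape-last : ∀ {c} → Shape c → ∃[ d ] c ≡ d ∷ʳ single
Shape-last (last-run k) = replicate k single ,
  trans (cong (λ n → replicate n single) (+-comm 1 k)) (replicate-+ k 1 single)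
Shape-last (run k m sh) with Shape-last sh
... | d , refl = replicate (suc k) single ++ replicate (suc m) pair ++ d ,
  trans (cong (replicate (suc k) single ++_) (sym (++-assoc (replicate (suc m) pair) d (single ∷ []))))
    (sym (++-assoc (replicate (suc k) single) (replicate (suc m) pair ++ d) (single ∷ [])))

Shape-suffix : ∀ {c} q y → Shape c → Shape (c ++ replicate (suc q) pair ++ replicate (suc y) single)
Shape-suffix q y (last-run k)       = run k q (last-run y)
Shape-suffix q y (run k m {c} sh) = subst Shape
  (trans (cong (replicate (suc k) single ++_) (sym (++-assoc (replicate (suc m) pair) c _)))
    (sym (++-assoc (replicate (suc k) single) (replicate (suc m) pair ++ c) _)))
  (run k m (Shape-suffix q y sh))

singles-++ : ∀ c d → singles (c ++ d) ≡ singles c + singles d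
singles-++ []           d = refl
singles-++ (single ∷ c) d = cong suc (singles-++ c d)
singles-++ (pair ∷ c)   d = singles-++ c d

singles-singles : ∀ n → singles (replicate n single) ≡ n
singles-singles zero    = refl
singles-singles (suc n) = cong suc (singles-singles n)

singles-pairs : ∀ n c → singles (replicate n pair ++ c) ≡ singles c
singles-pairs zero    c = refl
singles-pairs (suc n) c = singles-pairs n c

singles-run : ∀ k m c → singles (replicate k single ++ replicate m pair ++ c) ≡ k + singles c
singles-run k m c = trans (singles-++ (replicate k single) _) (cong₂ _+_ (singles-singles k) (singles-pairs m c))

word-∷ʳ : ∀ c → word (c ∷ʳ single) ≡ word c ∷ʳ S
word-∷ʳ []           = refl
word-∷ʳ (single ∷ c) = cong (S ∷_) (word-∷ʳ c)
word-∷ʳ (pair ∷ c)   = cong (λ w → P ∷ P ∷ w) (word-∷ʳ c)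

end-∷ʳ : ∀ v c → end v (c ∷ʳ single) ≡ 4 + end v c
end-∷ʳ v []           = refl
end-∷ʳ v (single ∷ c) = end-∷ʳ (4 + v) c
end-∷ʳ v (pair ∷ c)   = end-∷ʳ (6 + v) c

-- The bound makes `c` use up all singletons of the base parity, so that `d` starts with none left.
build-++ : ∀ v a c d → a ≤ singles c → build v a (c ++ d) ≡ build v a c ++ build (end v c) 0 d
build-++ v zero    []           d _       = refl
build-++ v zero    (single ∷ c) d _       = cong (suc v ∷_) (build-++ (4 + v) 0 c d z≤n)
build-++ v (suc a) (single ∷ c) d (s≤s p) = cong (v ∷_) (build-++ (4 + v) a c d p)
build-++ v a       (pair ∷ c)   d p       = cong (λ l → v ∷ 3 + v ∷ l) (build-++ (6 + v) a c d p)

last-∷ʳ : ∀ {A : Set} xs (x : A) → last (xs ∷ʳ x) ≡ just x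
last-∷ʳ []           x = refl
last-∷ʳ (_ ∷ [])     x = refl
last-∷ʳ (_ ∷ y ∷ xs) x = last-∷ʳ (y ∷ xs) x

-- As `a < singles c`, the final singleton carries the increment 1, so the base after it lies 3 and
-- not 4 above it.
last-build : ∀ {v a c e} → Shape c → a < singles c → last (build v a c) ≡ just e → 3 + e ≡ end v c
last-build {v} {a} {e = e} sh a< eq with Shape-last sh
... | d , refl = trans (cong (3 +_) e≡) (sym (end-∷ʳ v d))
  where
  a≤ : a ≤ singles d
  a≤ = ≤-pred (≤-trans a< (≤-reflexive (trans (singles-++ d (single ∷ [])) (+-comm (singles d) 1))))
  e≡ : e ≡ suc (end v d)
  e≡ = just-injective (trans (sym eq)
         (trans (cong last (build-++ v a d (single ∷ []) a≤)) (last-∷ʳ (build v a d) (suc (end v d)))))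

-- Arithmetic progressions

prog-suc : ∀ a d m → prog a d (suc m) ≡ a ∷ prog (d + a) d m
prog-suc a d m = cong₂ _∷_ (trans (cong (a +_) (*-zeroʳ d)) (+-identityʳ a)) (begin
  map (λ i → a + d * i) (applyUpTo suc m)      ≡⟨ cong (map _) (map-upTo suc m) ⟨
  map (λ i → a + d * i) (map suc (upTo m))     ≡⟨ map-∘ (upTo m) ⟨
  map (λ i → a + d * suc i) (upTo m)           ≡⟨ map-cong (lem a d) (upTo m) ⟩
  prog (d + a) d m                             ∎)
  where
  open ≡-Reasoning
  lem : ∀ a d i → a + d * suc i ≡ d + a + d * i
  lem = solve-∀

prog-∷ʳ : ∀ a d m → prog a d (suc m) ≡ prog a d m ∷ʳ (a + d * m)
prog-∷ʳ a d m = trans (cong (map _) (sym (upTo-∷ʳ m))) (map-++ _ (upTo m) (m ∷ []))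

last-++-prog : ∀ xs a d m → last (xs ++ prog a d (suc m)) ≡ just (a + d * m)
last-++-prog xs a d m = trans (cong last (trans (cong (xs ++_) (prog-∷ʳ a d m)) (sym (++-assoc xs (prog a d m) _))))
  (last-∷ʳ (xs ++ prog a d m) (a + d * m))

advance : ∀ n d v → n * d + (d + v) ≡ suc n * d + v
advance = solve-∀

odd-singles : ∀ n v a c → build v (n + a) (replicate n single ++ c) ≡ prog v 4 n ++ build (n * 4 + v) a c
odd-singles zero    v a c = refl
odd-singles (suc n) v a c =
  trans (cong (v ∷_) (trans (odd-singles n (4 + v) a c) (cong (λ w → prog (4 + v) 4 n ++ build w a c) (advance n 4 v))))
    (cong (_++ build (suc n * 4 + v) a c) (sym (prog-suc v 4 n)))

odd-singles-only : ∀ n v c → build v n (replicate n single ++ c) ≡ prog v 4 n ++ build (n * 4 + v) 0 c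
odd-singles-only n v c =
  trans (cong (λ a → build v a (replicate n single ++ c)) (sym (+-identityʳ n))) (odd-singles n v 0 c)

even-singles : ∀ n v c → build v 0 (replicate n single ++ c) ≡ prog (suc v) 4 n ++ build (n * 4 + v) 0 c
even-singles zero    v c = refl
even-singles (suc n) v c =
  trans (cong (suc v ∷_) (trans (even-singles n (4 + v) c) (cong (λ w → prog (5 + v) 4 n ++ build w 0 c) (advance n 4 v))))
    (cong (_++ build (suc n * 4 + v) 0 c) (sym (prog-suc (suc v) 4 n)))

even-singles-only : ∀ n v → build v 0 (replicate n single) ≡ prog (suc v) 4 n
even-singles-only n v = trans (cong (build v 0) (sym (++-identityʳ (replicate n single))))
  (trans (even-singles n v []) (++-identityʳ (prog (suc v) 4 n)))

-- Pairs fill a progression of step 3 two terms at a time, which matches the evenness of `p` in the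
-- constructors.
pair-run : ∀ n v a c → build v a (replicate n pair ++ c) ≡ prog v 3 (n * 2) ++ build (n * 6 + v) a c
pair-run zero    v a c = refl
pair-run (suc n) v a c =
  trans (cong (λ l → v ∷ 3 + v ∷ l)
          (trans (pair-run n (6 + v) a c) (cong (λ w → prog (6 + v) 3 (n * 2) ++ build w a c) (advance n 6 v))))
    (cong (_++ build (suc n * 6 + v) a c)
      (sym (trans (prog-suc v 3 (suc (n * 2))) (cong (v ∷_) (prog-suc (3 + v) 3 (n * 2))))))

single-run-prefix : ∀ k m v a c →
  build v (k + a) (replicate k single ++ replicate m pair ++ c)
    ≡ prog v 4 k ++ prog (k * 4 + v) 3 (m * 2) ++ build (m * 6 + (k * 4 + v)) a c
single-run-prefix k m v a c = trans (odd-singles k v a (replicate m pair ++ c)) (cong (prog v 4 k ++_) (pair-run m (k * 4 + v) a c))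

pair-run-suffix : ∀ m y v → build v 0 (replicate m pair ++ replicate y single)
                          ≡ prog v 3 (m * 2) ++ prog (suc (m * 6 + v)) 4 y
pair-run-suffix m y v = trans (pair-run m v 0 (replicate y single)) (cong (prog v 3 (m * 2) ++_) (even-singles-only y (m * 6 + v)))

advance-%2 : ∀ n v → (n * 4 + v) % 2 ≡ v % 2
advance-%2 zero    v = refl
advance-%2 (suc n) v = advance-%2 n v

advance₆-%2 : ∀ n v → (n * 6 + v) % 2 ≡ v % 2
advance₆-%2 zero    v = refl
advance₆-%2 (suc n) v = advance₆-%2 n v

advance₆-%3 : ∀ n v → (n * 6 + v) % 3 ≡ v % 3
advance₆-%3 zero    v = refl
advance₆-%3 (suc n) v = advance₆-%3 n v

Valid-singles : ∀ n v {c} → Valid (n * 4 + v) c → Valid v (replicate n single ++ c)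
Valid-singles zero    v     val = val
Valid-singles (suc n) v {c} val = Valid-singles n (4 + v) (subst (λ w → Valid w c) (sym (advance n 4 v)) val)

Valid-singles⁻ : ∀ n v {c} → Valid v (replicate n single ++ c) → Valid (n * 4 + v) c
Valid-singles⁻ zero    v     val = val
Valid-singles⁻ (suc n) v {c} val = subst (λ w → Valid w c) (advance n 4 v) (Valid-singles⁻ n (4 + v) val)

Valid-singles-only : ∀ n v → Valid v (replicate n single)
Valid-singles-only zero    v = _
Valid-singles-only (suc n) v = Valid-singles-only n (4 + v)

Valid-pairs : ∀ n v {c} → v % 3 ≢ 0 → Valid (n * 6 + v) c → Valid v (replicate n pair ++ c)
Valid-pairs zero    v     nz val = val
Valid-pairs (suc n) v {c} nz val = nz , Valid-pairs n (6 + v) nz (subst (λ w → Valid w c) (sym (advance n 6 v)) val)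

Valid-pairs⁻ : ∀ n v {c} → Valid v (replicate n pair ++ c) → Valid (n * 6 + v) c
Valid-pairs⁻ zero    v     val       = val
Valid-pairs⁻ (suc n) v {c} (_ , val) = subst (λ w → Valid w c) (advance n 6 v) (Valid-pairs⁻ n (6 + v) val)

Valid-++ : ∀ v c {d} → Valid v c → Valid (end v c) d → Valid v (c ++ d)
Valid-++ v []           _          val′ = val′
Valid-++ v (single ∷ c) val        val′ = Valid-++ (4 + v) c val val′
Valid-++ v (pair ∷ c)   (nz , val) val′ = nz , Valid-++ (6 + v) c val val′

-- The parametrisation of minimal segments

-- Here `a` and `b` are one less than the numbers of odd and even singletons, since a segment has at
-- least one of each.
record Code (s a b : ℕ) (c : List Token) : Set where
  field
    odd   : s % 2 ≡ 1
    large : 3 < s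
    shape : Shape c
    valid : Valid s c
    total : suc a + suc b ≡ singles c

swap : ∀ {s a b c} → Code s a b c → Code s b a c
swap {a = a} {b} k = record { Code k ; total = trans (+-comm (suc b) (suc a)) (Code.total k) }

head-build : ∀ {v a c} → Shape c → head (build v (suc a) c) ≡ just v
head-build sh with Shape-head sh
... | _ , refl = refl

even⇒double : ∀ p → IsEven p → 2 ≤ p → ∃[ q ] p ≡ suc q * 2
even⇒double p even 2≤p with m%n≡0⇒n∣m p 2 even
... | divides zero    refl = case 2≤p of λ ()
... | divides (suc q) eq   = q , eq

-- Along a derivation, `suffix` appends even singletons and `prefix` prepends odd ones, so the odd
-- singletons always precede the even ones, as in `build`.
encode : ∀ {π} → UpperMinSeg π → ∃[ s ] ∃[ a ] ∃[ b ] ∃[ c ] (Code s a b c × π ≡ build s (suc a) c)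
encode (prim₁ o x y odd 3<o sch) = o , x , y , replicate (suc x) single ++ replicate (suc y) single ,
  record
    { odd = odd ; large = 3<o
    ; shape = subst Shape (replicate-+ (suc x) (suc y) single) (last-run (x + suc y))
    ; valid = Valid-singles (suc x) o (Valid-singles-only (suc y) _)
    ; total = sym (trans (singles-++ (replicate (suc x) single) _) (cong₂ _+_ (singles-singles (suc x)) (singles-singles (suc y))))
    } ,
  sym (trans (odd-singles-only (suc x) o _) (cong (prog o 4 (suc x) ++_)
    (trans (even-singles-only (suc y) _) (cong (λ w → prog w 4 (suc y)) (lem o x)))))
  where
  lem : ∀ o x → suc (suc x * 4 + o) ≡ o + 4 * x + 5
  lem = solve-∀
encode (prim₂ o x p (suc y) odd 3<o _ 2≤p even nz sch) with even⇒double p even 2≤p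
... | q , refl = o , x , y , replicate (suc x) single ++ replicate (suc q) pair ++ replicate (suc y) single ,
  record
    { odd = odd ; large = 3<o
    ; shape = run x q (last-run y)
    ; valid = Valid-singles (suc x) o (Valid-pairs (suc q) _ (λ e → nz (trans (cong (_% 3) (lem₀ o x)) e))
                (Valid-singles-only (suc y) _))
    ; total = sym (trans (singles-run (suc x) (suc q) _) (cong (suc x +_) (singles-singles (suc y))))
    } ,
  sym (trans (odd-singles-only (suc x) o _) (cong (prog o 4 (suc x) ++_)
    (trans (pair-run-suffix (suc q) (suc y) (suc x * 4 + o))
      (cong₂ (λ u w → prog u 3 (suc q * 2) ++ prog w 4 (suc y)) (lem₁ o x) (lem₂ o x q)))))
  where
  lem₀ : ∀ o x → 3 + (o + 4 * x + 1) ≡ suc x * 4 + o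
  lem₀ = solve-∀
  lem₁ : ∀ o x → suc x * 4 + o ≡ o + 4 * x + 1 + 3
  lem₁ = solve-∀
  lem₂ : ∀ o x q → suc (suc q * 6 + (suc x * 4 + o)) ≡ o + 4 * x + 1 + 3 * (suc q * 2) + 4
  lem₂ = solve-∀
encode (suffix Σ' e p (suc y) um last≡ _ nz 2≤p even _ sch) with even⇒double p even 2≤p | encode um
... | q , refl | s , a , b , c , k , refl = s , a , b + suc y , c ++ d ,
  record
    { odd = odd ; large = large
    ; shape = Shape-suffix q y shape
    ; valid = Valid-++ s c valid (Valid-pairs (suc q) _ (λ z → nz (trans (cong (_% 3) e+3≡) z)) (Valid-singles-only (suc y) _))
    ; total = trans (sym (+-assoc (suc a) (suc b) (suc y)))
                (sym (trans (singles-++ c d) (cong₂ _+_ (sym total) (trans (singles-pairs (suc q) _) (singles-singles (suc y))))))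
    } ,
  sym (trans (build-++ s (suc a) c d (<⇒≤ a<)) (cong (build s (suc a) c ++_)
    (trans (pair-run-suffix (suc q) (suc y) (end s c))
      (cong₂ (λ u w → prog u 3 (suc q * 2) ++ prog w 4 (suc y))
        (trans (sym e+3≡) (+-comm 3 e))
        (trans (cong (λ u → suc (suc q * 6 + u)) (sym e+3≡)) (lem e q))))))
  where
  open Code k
  d = replicate (suc q) pair ++ replicate (suc y) single
  a< : suc a < singles c
  a< = ≤-trans (m<m+n (suc a) z<s) (≤-reflexive total)
  -- The appended block of pairs has base `3 + e`, so the condition on `e` modulo 3 becomes its
  -- validity.
  e+3≡ : 3 + e ≡ end s c
  e+3≡ = last-build shape a< last≡
  lem : ∀ e q → suc (suc q * 6 + (3 + e)) ≡ e + 3 * (suc q * 2) + 4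
  lem = solve-∀
encode (prefix Σ' o o' k p um head≡ o≡ nz odd 3<o' 2≤p even sch) with even⇒double p even 2≤p | encode um
... | q , refl | s , a , b , c , code , refl with just-injective (trans (sym head≡) (head-build {a = a} (Code.shape code)))
-- There are now `suc k + suc a` odd singletons, and the code stores one less.
...   | refl = o' , k + suc a , b , replicate (suc k) single ++ replicate (suc q) pair ++ c ,
  record
    { odd = odd ; large = 3<o'
    ; shape = run k q shape
    -- The part `o` lies a multiple of 6 above the base of the new block, so both have the same
    -- residue modulo 3.
    ; valid = Valid-singles (suc k) o' (Valid-pairs (suc q) _
                (λ z → nz (trans (cong (_% 3) (sym s≡)) (trans (advance₆-%3 (suc q) (suc k * 4 + o')) z)))
                (subst (λ w → Valid w c) (sym s≡) valid))
    ; total = trans (+-assoc (suc k) (suc a) (suc b)) (trans (cong (suc k +_) total) (sym (singles-run (suc k) (suc q) c)))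
    } ,
  sym (trans (single-run-prefix (suc k) (suc q) o' (suc a) c)
    (cong₂ (λ u w → prog o' 4 (suc k) ++ prog u 3 (suc q * 2) ++ build w (suc a) c) (lem′ o' k) s≡))
  where
  open Code code hiding (odd; large)
  lem : ∀ o' k q → suc q * 6 + (suc k * 4 + o') ≡ o' + 4 * k + 3 * (suc q * 2 + 1) + 1
  lem = solve-∀
  lem′ : ∀ o' k → suc k * 4 + o' ≡ o' + 4 * k + 4
  lem′ = solve-∀
  s≡ : suc q * 6 + (suc k * 4 + o') ≡ o
  s≡ = trans (lem o' k q) (sym o≡)

-- Construction of minimal segments

schurAdj : ∀ {x y} → x + 3 ≤ y → x + 4 ≤ y ⊎ x % 3 ≢ 0 ⊎ y % 3 ≢ 0 → SchurAdj x y
schurAdj {x} le (inj₁ le′)       = le , λ eq → ⊥-elim (<⇒≢ (≤-trans (≤-reflexive (sym (+-suc x 3))) le′) (sym eq))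
schurAdj le (inj₂ (inj₁ nz)) = le , λ _ → nz ∘ proj₁
schurAdj le (inj₂ (inj₂ nz)) = le , λ _ → nz ∘ proj₂

-- Here `x` is the preceding part. A pair at `v` is prime to 3 and a singleton at `suc v` leaves a
-- gap of 4, so only a singleton at `v` itself needs the disjunction, whose last alternative says
-- that none is left.
Linked-build : ∀ x v a c → x + 3 ≤ v → x + 4 ≤ v ⊎ x % 3 ≢ 0 ⊎ a ≡ 0 → Valid v c →
               Linked SchurAdj (x ∷ build v a c)
Linked-build x v a       []           le d val        = [-]
Linked-build x v a       (pair ∷ c)   le d (nz , val) =
  schurAdj le (inj₂ (inj₂ nz)) ∷ schurAdj (≤-reflexive (+-comm v 3)) (inj₂ (inj₁ nz))
  ∷ Linked-build (3 + v) (6 + v) a c (≤-reflexive (+-comm (3 + v) 3)) (inj₂ (inj₁ nz)) val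
Linked-build x v zero    (single ∷ c) le d val        =
  schurAdj (≤-trans le (n≤1+n v)) (inj₁ (≤-trans (≤-reflexive (+-suc x 3)) (s≤s le)))
  ∷ Linked-build (suc v) (4 + v) zero c (≤-reflexive (+-comm (suc v) 3)) (inj₂ (inj₂ refl)) val
Linked-build x v (suc a) (single ∷ c) le d val        =
  schurAdj le (d′ d) ∷ Linked-build v (4 + v) a c (≤-trans (≤-reflexive (+-comm v 3)) (n≤1+n _)) (inj₁ (≤-reflexive (+-comm v 4))) val
  where
  d′ : x + 4 ≤ v ⊎ x % 3 ≢ 0 ⊎ suc a ≡ 0 → x + 4 ≤ v ⊎ x % 3 ≢ 0 ⊎ v % 3 ≢ 0
  d′ (inj₁ p)        = inj₁ p
  d′ (inj₂ (inj₁ p)) = inj₂ (inj₁ p)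

Schur-build : ∀ v a c → 3 < v → Valid v c → Schur (build v a c)
Schur-build v a c 3<v val =
  All.tabulate (λ m → ≤-trans z<s (≤-trans 3<v (∈-build⇒≥ v a c m))) ,
  -- An auxiliary part 0 in front, at distance at least 4, serves as predecessor and is then
  -- dropped.
  Linked.tail (Linked-build 0 v a c (<⇒≤ 3<v) (inj₁ 3<v) val)

Schur-++ˡ : ∀ xs {ys} → Schur (xs ++ ys) → Schur xs
Schur-++ˡ xs (pos , adj) = ++⁻ˡ xs pos , linked xs adj
  where
  linked : ∀ xs {ys} → Linked SchurAdj (xs ++ ys) → Linked SchurAdj xs
  linked []           _          = []
  linked (x ∷ [])     _          = [-]
  linked (x ∷ y ∷ xs) (r ∷ rest) = r ∷ linked (y ∷ xs) rest

-- Suffixes are attached from left to right; the length of the last run of even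
-- singletons is left open because it is dictated by the first run of c.
grow : ∀ {c} → Shape c → ∀ Σ' v → v % 2 ≡ 1 →
  (∀ k → let π = Σ' ++ prog (suc v) 4 (suc k) in Schur π → UpperMinSeg π) →
  Valid v c → Schur (Σ' ++ build v 0 c) → UpperMinSeg (Σ' ++ build v 0 c)
grow (last-run k) Σ' v odd base val sch =
  subst UpperMinSeg (cong (Σ' ++_) (sym (even-singles-only (suc k) v)))
    (base k (subst Schur (cong (Σ' ++_) (even-singles-only (suc k) v)) sch))
grow (run k m {c} sh) Σ' v odd base val sch =
  subst UpperMinSeg (sym list≡) (grow sh (Σ'A ++ B) v′ odd′ base′ (Valid-pairs⁻ (suc m) u val′) sch′)
  where
  u = suc k * 4 + v
  v′ = suc m * 6 + u
  A = prog (suc v) 4 (suc k)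
  B = prog u 3 (suc m * 2)
  Σ'A = Σ' ++ A
  e = suc v + 4 * k
  val′ = Valid-singles⁻ (suc k) v val
  u≡ : ∀ v k → suc k * 4 + v ≡ 3 + (suc v + 4 * k)
  u≡ = solve-∀
  list≡ : Σ' ++ build v 0 (replicate (suc k) single ++ replicate (suc m) pair ++ c) ≡ (Σ'A ++ B) ++ build v′ 0 c
  list≡ = trans (cong (Σ' ++_) (trans (even-singles (suc k) v _) (cong (A ++_) (pair-run (suc m) u 0 c))))
    (trans (sym (++-assoc Σ' A _)) (sym (++-assoc Σ'A B _)))
  sch′ : Schur ((Σ'A ++ B) ++ build v′ 0 c)
  sch′ = subst Schur list≡ sch
  odd′ : v′ % 2 ≡ 1
  odd′ = trans (advance₆-%2 (suc m) u) (trans (advance-%2 (suc k) v) odd)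
  e-even : e % 2 ≡ 0
  e-even = trans (cong (_% 2) (lem v k)) (trans (advance-%2 k (suc v)) (odd⇒suc-even v odd))
    where
    lem : ∀ v k → suc v + 4 * k ≡ k * 4 + suc v
    lem = solve-∀
  -- Fixing the current run at length `suc k` permits the suffix rule, and the run behind the new
  -- block becomes the open one.
  base′ : ∀ j → let π = (Σ'A ++ B) ++ prog (suc v′) 4 (suc j) in Schur π → UpperMinSeg π
  base′ j schur = subst UpperMinSeg eq
    (suffix Σ'A e (suc m * 2) (suc j) (base k (Schur-++ˡ Σ'A (Schur-++ˡ (Σ'A ++ B) schur)))
      (last-++-prog Σ' (suc v) 4 k) e-even (λ z → proj₁ val′ (trans (cong (_% 3) (u≡ v k)) z))
      (s≤s (s≤s z≤n)) (m*n%n≡0 (suc m) 2) z<s (subst Schur (sym eq) schur))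
    where
    lem₁ : ∀ v k → suc v + 4 * k + 3 ≡ suc k * 4 + v
    lem₁ = solve-∀
    lem₂ : ∀ v k m → suc v + 4 * k + 3 * (suc m * 2) + 4 ≡ suc (suc m * 6 + (suc k * 4 + v))
    lem₂ = solve-∀
    eq : Σ'A ++ prog (e + 3) 3 (suc m * 2) ++ prog (e + 3 * (suc m * 2) + 4) 4 (suc j)
         ≡ (Σ'A ++ B) ++ prog (suc v′) 4 (suc j)
    eq = trans (cong₂ (λ x y → Σ'A ++ prog x 3 (suc m * 2) ++ prog y 4 (suc j)) (lem₁ v k) (lem₂ v k m))
           (sym (++-assoc Σ'A B _))

module _ {s : ℕ} (odd : s % 2 ≡ 1) (3<s : 3 < s) (a : ℕ) where

  -- The odd singletons end inside a run of singles, so the growth starts from `prim₁`.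
  centre₁ : ∀ {c} → Shape c → Valid s (replicate (suc a) single ++ c) →
            UpperMinSeg (build s (suc a) (replicate (suc a) single ++ c))
  centre₁ {c} sh val = subst UpperMinSeg (sym list≡)
    (grow sh (prog s 4 (suc a)) (suc a * 4 + s) (trans (advance-%2 (suc a) s) odd) base
      (Valid-singles⁻ (suc a) s val)
      (subst Schur list≡ (Schur-build s (suc a) (replicate (suc a) single ++ c) 3<s val)))
    where
    list≡ = odd-singles-only (suc a) s c
    lem : ∀ s a → s + 4 * a + 5 ≡ suc (suc a * 4 + s)
    lem = solve-∀
    base : ∀ k → let π = prog s 4 (suc a) ++ prog (suc (suc a * 4 + s)) 4 (suc k) in Schur π → UpperMinSeg π
    base k schur = subst UpperMinSeg eq (prim₁ s a k odd 3<s (subst Schur (sym eq) schur))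
      where eq = cong (λ x → prog s 4 (suc a) ++ prog x 4 (suc k)) (lem s a)

  -- The odd singletons end at a block of pairs, so the growth starts from `prim₂`.
  centre₂ : ∀ {c} m → Shape c → Valid s (replicate (suc a) single ++ replicate (suc m) pair ++ c) →
            UpperMinSeg (build s (suc a) (replicate (suc a) single ++ replicate (suc m) pair ++ c))
  centre₂ {c} m sh val = subst UpperMinSeg (sym list≡)
    (grow sh (A ++ B) (suc m * 6 + u) (trans (advance₆-%2 (suc m) u) (trans (advance-%2 (suc a) s) odd)) base
      (Valid-pairs⁻ (suc m) u val′)
      (subst Schur list≡ (Schur-build s (suc a) (replicate (suc a) single ++ replicate (suc m) pair ++ c) 3<s val)))
    where
    u = suc a * 4 + s
    A = prog s 4 (suc a)
    B = prog u 3 (suc m * 2)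
    val′ = Valid-singles⁻ (suc a) s val
    list≡ : build s (suc a) (replicate (suc a) single ++ replicate (suc m) pair ++ c) ≡ (A ++ B) ++ build (suc m * 6 + u) 0 c
    list≡ = trans (odd-singles-only (suc a) s _) (trans (cong (A ++_) (pair-run (suc m) u 0 c)) (sym (++-assoc A B _)))
    lem₀ : ∀ s a → suc a * 4 + s ≡ 3 + (s + 4 * a + 1)
    lem₀ = solve-∀
    lem₁ : ∀ s a → s + 4 * a + 1 + 3 ≡ suc a * 4 + s
    lem₁ = solve-∀
    lem₂ : ∀ s a m → s + 4 * a + 1 + 3 * (suc m * 2) + 4 ≡ suc (suc m * 6 + (suc a * 4 + s))
    lem₂ = solve-∀
    base : ∀ k → let π = (A ++ B) ++ prog (suc (suc m * 6 + u)) 4 (suc k) in Schur π → UpperMinSeg π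
    base k schur = subst UpperMinSeg eq
      (prim₂ s a (suc m * 2) (suc k) odd 3<s z<s (s≤s (s≤s z≤n)) (m*n%n≡0 (suc m) 2)
        (λ z → proj₁ val′ (trans (cong (_% 3) (lem₀ s a)) z)) (subst Schur (sym eq) schur))
      where
      eq = trans (cong₂ (λ x y → A ++ prog x 3 (suc m * 2) ++ prog y 4 (suc k)) (lem₁ s a) (lem₂ s a m))
             (sym (++-assoc A B _))

-- The centre is where the odd singletons run out. If it lies beyond the first block of pairs, the
-- first run and that block come off by the prefix rule; otherwise `centre₁` or `centre₂` applies.
construct : ∀ {s a b c} → Code s a b c → UpperMinSeg (build s (suc a) c)
construct code = go (Code.shape code) _ _ _ (Code.odd code) (Code.large code) (Code.valid code) (Code.total code)
  where
  go : ∀ {c} → Shape c → ∀ s a b → s % 2 ≡ 1 → 3 < s → Valid s c → suc a + suc b ≡ singles c →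
       UpperMinSeg (build s (suc a) c)
  go (last-run k) s a b odd 3<s val eq
    with suc-injective (trans eq (singles-singles (suc k)))
  ... | refl = subst (λ c → Valid s c → UpperMinSeg (build s (suc a) c))
                 (sym (replicate-+ (suc a) (suc b) single)) (centre₁ odd 3<s a (last-run b)) val
  go (run k m {c} sh) s a b odd 3<s val eq with ℕ.compare a k
  ... | ℕ.less a j = subst (λ c → Valid s c → UpperMinSeg (build s (suc a) c)) (sym split)
                     (centre₁ odd 3<s a (run j m sh)) val
    where
    split : replicate (2 + (a + j)) single ++ replicate (suc m) pair ++ c
          ≡ replicate (suc a) single ++ replicate (suc j) single ++ replicate (suc m) pair ++ c
    split = trans (cong (_++ replicate (suc m) pair ++ c)
                    (trans (cong (λ n → replicate (suc n) single) (sym (+-suc a j))) (replicate-+ (suc a) (suc j) single)))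
              (++-assoc (replicate (suc a) single) (replicate (suc j) single) _)
  ... | ℕ.equal a = centre₂ odd 3<s a m sh val
  -- The old index is now `suc (k + a)`: of the odd singletons, `suc k` form the first run and
  -- `suc a` remain for the recursive call.
  ... | ℕ.greater k a = subst UpperMinSeg list≡
    (prefix (build s′ (suc a) c) s′ s k (suc m * 2) (go sh s′ a b odd′ 3<s′ val″ eq′)
      (head-build {a = a} sh) (lem₁ s k m) (λ z → proj₁ val′ (trans (sym (advance₆-%3 (suc m) u)) z))
      odd 3<s (s≤s (s≤s z≤n)) (m*n%n≡0 (suc m) 2)
      (subst Schur (sym list≡)
        (Schur-build s (2 + (k + a)) (replicate (suc k) single ++ replicate (suc m) pair ++ c) 3<s val)))
    where
    u = suc k * 4 + s
    s′ = suc m * 6 + u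
    odd′ : s′ % 2 ≡ 1
    odd′ = trans (advance₆-%2 (suc m) u) (trans (advance-%2 (suc k) s) odd)
    3<s′ : 3 < s′
    3<s′ = ≤-trans 3<s (≤-trans (m≤n+m s (suc k * 4)) (m≤n+m u (suc m * 6)))
    val′ = Valid-singles⁻ (suc k) s val
    val″ = Valid-pairs⁻ (suc m) u val′
    lem₀ : ∀ k a b → suc k + (suc a + suc b) ≡ 2 + (k + a) + suc b
    lem₀ = solve-∀
    lem₁ : ∀ s k m → suc m * 6 + (suc k * 4 + s) ≡ s + 4 * k + 3 * (suc m * 2 + 1) + 1
    lem₁ = solve-∀
    lem₂ : ∀ s k → s + 4 * k + 4 ≡ suc k * 4 + s
    lem₂ = solve-∀
    eq′ : suc a + suc b ≡ singles c
    eq′ = +-cancelˡ-≡ (suc k) _ _ (trans (lem₀ k a b) (trans eq (singles-run (suc k) (suc m) c)))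
    list≡ : prog s 4 (suc k) ++ prog (s + 4 * k + 4) 3 (suc m * 2) ++ build s′ (suc a) c
          ≡ build s (2 + (k + a)) (replicate (suc k) single ++ replicate (suc m) pair ++ c)
    list≡ = trans (cong (λ x → prog s 4 (suc k) ++ prog x 3 (suc m * 2) ++ build s′ (suc a) c) (lem₂ s k))
      (trans (sym (single-run-prefix (suc k) (suc m) s (suc a) c))
        (cong (λ n → build s (suc n) (replicate (suc k) single ++ replicate (suc m) pair ++ c)) (+-suc k a)))

-- The bijection

-- The smallest part is odd and exceeds 3, hence is at least 5, and lowering it by 3 leaves at least
-- 2.
base>1 : ∀ {v a b c} → Code (3 + v) a b c → 1 < v
base>1 {0}           k = case Code.large k of λ { (s≤s (s≤s (s≤s ()))) }
base>1 {1}           k = case Code.odd k of λ ()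
base>1 {suc (suc v)} k = s≤s z<s

base-even : ∀ {v a b c} → Code (3 + v) a b c → v % 2 ≡ 0
base-even {v} k = suc-odd⇒even v (Code.odd k)

encode′ : ∀ {π} → UpperMinSeg π → ∃[ v ] ∃[ a ] ∃[ b ] ∃[ c ] (Code (3 + v) a b c × π ≡ build (3 + v) (suc a) c)
encode′ um with encode um
... | suc (suc (suc v)) , a , b , c , k , eq = v , a , b , c , k , eq
... | 0 , _ , _ , _ , k , _ = case Code.large k of λ ()
... | 1 , _ , _ , _ , k , _ = case Code.large k of λ { (s≤s ()) }
... | 2 , _ , _ , _ , k , _ = case Code.large k of λ { (s≤s (s≤s ())) }

Pointwise-last : ∀ {R : ℕ → Letter → Set} {xs} W {w} → Pointwise R xs (W ∷ʳ w) → ∃[ x ] (last xs ≡ just x × R x w)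
Pointwise-last []           (r ∷ [])        = _ , refl , r
Pointwise-last (_ ∷ [])     (_ ∷ r ∷ [])    = _ , refl , r
Pointwise-last (_ ∷ w ∷ W) (_ ∷ r ∷ rs)    = Pointwise-last (w ∷ W) (r ∷ rs)

singleton : ∀ Q {x} → LetterOf Q x S → ¬ Q x
singleton Q (inj₂ (_ , n)) = n

-- Shapes begin and end with `single`, so the lower codeword begins and ends with `S`, as the
-- condition on the extreme parts demands.
construct-lower : ∀ {v a b c} → Code (3 + v) a b c → LowerMinSeg (build v (suc a) c)
construct-lower {v} {a} {b} {c} k = 
  build (3 + v) (suc a) c , construct k , sym (h-build v (suc a) c) ,
  ends (Code.shape k) (lowerCodeword-build v (suc a) c (base-even k) (base>1 k))
  where
  λ′ = build v (suc a) c
  ends : Shape c → LowerCodeword λ′ (word c) →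
         ∃[ x ] ∃[ y ] (head λ′ ≡ just x × last λ′ ≡ just y × ¬ InLowerPair λ′ x × ¬ InLowerPair λ′ y)
  ends sh cw with Shape-last sh
  ... | d , e with Pointwise-last (word d) (subst (LowerCodeword λ′) (trans (cong word e) (word-∷ʳ d)) cw)
  ...   | y , last≡ , ly = v , y , head-build sh , last≡ , first , singleton (InLowerPair λ′) ly
    where
    first : ¬ InLowerPair λ′ v
    first with Shape-head sh
    ... | _ , refl = singleton (InLowerPair λ′) (Pointwise.head cw)

-- The new base is even, so the second argument of `build` is the number of even singletons of `π`;
-- each pair accounts for one further even part. The default 0 concerns only the empty list, which
-- is no segment.
ρ : List ℕ → List ℕ
ρ π = build (fromMaybe 0 (head π) ∸ 3) (numEven π ∸ pairs c) c
  where c = decode 1 π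

decode-upper : ∀ {v a b c} n → Code (3 + v) a b c → decode 1 (build (3 + v) n c) ≡ c
decode-upper {v} {c = c} n k = decode-build 1 (3 + v) n c (Code.odd k)
  λ e → case trans (sym (odd⇒suc-even (3 + v) (Code.odd k))) e of λ ()

decode-lower : ∀ {v a b c} n → Code (3 + v) a b c → decode 0 (build v n c) ≡ c
decode-lower {v} {c = c} n k = decode-build 0 v n c (base-even k)
  λ e → case trans (sym e) (Code.odd k) of λ ()

ρ-build : ∀ {v a b c} → Code (3 + v) a b c → ρ (build (3 + v) (suc a) c) ≡ build v (suc b) c
ρ-build {v} {a} {b} {c} k
  rewrite decode-upper (suc a) k | head-build {3 + v} {a} (Code.shape k)
        | numEven-build (3 + v) (suc a) (suc b) c (Code.odd k) (Code.total k)
        | m+n∸n≡m (suc b) (pairs c) = refl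

shift-ℤ : ∀ l k → ℤ.+ (l + k) ℤ.- ℤ.+ k ≡ ℤ.+ l
shift-ℤ l k = trans (ℤ.m-n≡m⊖n (l + k) k) (trans (ℤ.⊖-≥ (m≤n+m k l)) (cong ℤ.+_ (m+n∸n≡m l k)))

-- That `n` is at least `k` comes out of the integer equation itself, whose left side is a natural
-- number.
cancel-shift-ℤ : ∀ l n k → ℤ.+ l ≡ ℤ.+ n ℤ.- ℤ.+ k → n ≡ l + k
cancel-shift-ℤ l n k eq = ℤ.+-injective (begin
  ℤ.+ n                               ≡⟨ ℤ.+-identityʳ (ℤ.+ n) ⟨
  ℤ.+ n ℤ.+ ℤ.0ℤ                      ≡⟨ cong (λ i → ℤ.+ n ℤ.+ i) (ℤ.+-inverseˡ (ℤ.+ k)) ⟨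
  ℤ.+ n ℤ.+ (ℤ.- ℤ.+ k ℤ.+ ℤ.+ k)     ≡⟨ ℤ.+-assoc (ℤ.+ n) (ℤ.- ℤ.+ k) (ℤ.+ k) ⟨
  ℤ.+ n ℤ.- ℤ.+ k ℤ.+ ℤ.+ k           ≡⟨ cong (λ i → i ℤ.+ ℤ.+ k) eq ⟨
  ℤ.+ (l + k)                         ∎)
  where open ≡-Reasoning

module Swap {v a b c} (k : Code (3 + v) a b c) where
  open Code k

  upper lower : List ℕ
  upper = build (3 + v) (suc a) c
  lower = build v (suc b) c

  -- Exchanging the counts and lowering the base by 3 both reverse parities, so `suc a` counts the
  -- odd singletons of either list.
  numOdd-swap : numOdd lower ≡ numOdd upper
  numOdd-swap = trans (numOdd-build′ v (suc a) (suc b) c (base-even k) (Code.total (swap k)))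
                      (sym (numOdd-build (3 + v) (suc a) (suc b) c odd total))

  numEven-swap : numEven lower ≡ numEven upper
  numEven-swap = trans (numEven-build′ v (suc a) (suc b) c (base-even k) (Code.total (swap k)))
                       (sym (numEven-build (3 + v) (suc a) (suc b) c odd total))

  sum-swap : sum upper ≡ sum lower + 2 * (numOdd upper + 2 * numEven upper)
  sum-swap = trans (sum-build-swap v (suc a) (suc b) c total)
    (cong₂ (λ x y → sum lower + 2 * (x + 2 * y))
      (sym (numOdd-build (3 + v) (suc a) (suc b) c odd total))
      (sym (numEven-build (3 + v) (suc a) (suc b) c odd total)))

  upper-codeword : UpperCodeword upper (word c)
  upper-codeword = upperCodeword-build (3 + v) (suc a) c odd

  lower-codeword : LowerCodeword lower (word c)
  lower-codeword = lowerCodeword-build v (suc b) c (base-even k) (base>1 k)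

  pairCount-swap : ∀ r → pairCount r upper (word c) ≡ pairCount r lower (word c)
  pairCount-swap r = pairCount-build r v (suc a) (suc b) c

  𝒰⇒ℒ : ∀ {ω ε p₁ p₂ n} → 𝒰 ω ε p₁ p₂ n upper → ℒ ω ε p₁ p₂ (ℤ.+ n ℤ.- ℤ.+ (2 * (ω + 2 * ε))) lower
  𝒰⇒ℒ (_ , refl , refl , refl , W , cw , refl , refl) with word-unique {InUpperPair upper} cw upper-codeword
  ... | refl = construct-lower (swap k) ,
    sym (trans (cong (λ n → ℤ.+ n ℤ.- ℤ.+ (2 * (numOdd upper + 2 * numEven upper))) sum-swap)
      (shift-ℤ (sum lower) (2 * (numOdd upper + 2 * numEven upper)))) ,
    numOdd-swap , numEven-swap , word c , lower-codeword , sym (pairCount-swap 1) , sym (pairCount-swap 2)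

  ℒ⇒𝒰 : ∀ {ω ε p₁ p₂ n} → ℒ ω ε p₁ p₂ (ℤ.+ n ℤ.- ℤ.+ (2 * (ω + 2 * ε))) lower → 𝒰 ω ε p₁ p₂ n upper
  ℒ⇒𝒰 {n = n} (_ , sum≡ , refl , refl , W , cw , refl , refl) with word-unique {InLowerPair lower} cw lower-codeword
  ... | refl = construct k ,
    trans sum-swap (trans (cong₂ (λ x y → sum lower + 2 * (x + 2 * y)) (sym numOdd-swap) (sym numEven-swap))
      (sym (cancel-shift-ℤ (sum lower) n _ sum≡))) ,
    sym numOdd-swap , sym numEven-swap , word c , upper-codeword , pairCount-swap 1 , pairCount-swap 2

-- The image returns the tokens through `decode 0` and the base as its head; the number of odd parts
-- then fixes the number of odd singletons.
ρ-injective : ∀ {π π′} → UpperMinSeg π → UpperMinSeg π′ → numOdd π ≡ numOdd π′ →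
              ρ π ≡ ρ π′ → π ≡ π′
ρ-injective um um′ odds≡ eq with encode′ um | encode′ um′
... | v , a , b , c , k , refl | v′ , a′ , b′ , c′ , k′ , refl
  with trans (sym (ρ-build k)) (trans eq (ρ-build k′))
...   | lower≡ with trans (sym (decode-lower (suc b) k)) (trans (cong (decode 0) lower≡) (decode-lower (suc b′) k′))
...     | refl with just-injective 
           (trans (sym (head-build {v} {b} (Code.shape k)))
             (trans (cong head lower≡) (head-build {v′} {b′} (Code.shape k′))))
...       | refl = cong (λ x → build (3 + v) x c) (+-cancelʳ-≡ (pairs c) (suc a) (suc a′)
  (trans (sym (numOdd-build (3 + v) (suc a) (suc b) c (Code.odd k) (Code.total k)))
    (trans odds≡ (numOdd-build (3 + v) (suc a′) (suc b′) c (Code.odd k′) (Code.total k′)))))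

theorem2 : ∀ (ω ε p₁ p₂ n : ℕ) →
    let m = ℤ.+ n ℤ.- ℤ.+ (2 * (ω + 2 * ε)) in
    Σ (List ℕ → List ℕ) λ ρ → ((∀ π → 𝒰 ω ε p₁ p₂ n π → ℒ ω ε p₁ p₂ m (ρ π))
    × (∀ π π′ → 𝒰 ω ε p₁ p₂ n π → 𝒰 ω ε p₁ p₂ n π′ → ρ π ≡ ρ π′ → π ≡ π′)
    × (∀ λ′ → ℒ ω ε p₁ p₂ m λ′ → ∃[ π ] (𝒰 ω ε p₁ p₂ n π × ρ π ≡ λ′))
    × (∀ π → 𝒰 ω ε p₁ p₂ n π → ∀ W → UpperCodeword π W → LowerCodeword (ρ π) W)
    × (∀ π → 𝒰 ω ε p₁ p₂ n π → head π ≡ Maybe.map (_+ 3) (head (ρ π))))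
theorem2 ω ε p₁ p₂ n = ρ , into , injective , onto , codewords , heads
  where
  m = ℤ.+ n ℤ.- ℤ.+ (2 * (ω + 2 * ε))

  into : ∀ π → 𝒰 ω ε p₁ p₂ n π → ℒ ω ε p₁ p₂ m (ρ π)
  into π u with encode′ (proj₁ u)
  ... | v , a , b , c , k , refl = subst (ℒ ω ε p₁ p₂ m) (sym (ρ-build k)) (Swap.𝒰⇒ℒ k u)

  injective : ∀ π π′ → 𝒰 ω ε p₁ p₂ n π → 𝒰 ω ε p₁ p₂ n π′ → ρ π ≡ ρ π′ → π ≡ π′
  injective π π′ (um , _ , ω≡ , _) (um′ , _ , ω′≡ , _) = ρ-injective um um′ (trans ω≡ (sym ω′≡))

  onto : ∀ λ′ → ℒ ω ε p₁ p₂ m λ′ → ∃[ π ] (𝒰 ω ε p₁ p₂ n π × ρ π ≡ λ′)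
  onto λ′ l@((Σ' , um , λ≡ , _) , _) with encode′ um
  ... | v , a , b , c , k , refl with trans λ≡ (h-build v (suc a) c)
  -- The given segment is `h` of one with counts `a` and `b`; its preimage has the counts exchanged,
  -- and `ρ` exchanges them back.
  ...   | refl = build (3 + v) (suc b) c , Swap.ℒ⇒𝒰 (swap k) l , ρ-build (swap k)

  codewords : ∀ π → 𝒰 ω ε p₁ p₂ n π → ∀ W → UpperCodeword π W → LowerCodeword (ρ π) W
  codewords π u W cw with encode′ (proj₁ u)
  ... | v , a , b , c , k , refl
    rewrite word-unique {InUpperPair (build (3 + v) (suc a) c)} cw (Swap.upper-codeword k) | ρ-build k =
      Swap.lower-codeword k

  heads : ∀ π → 𝒰 ω ε p₁ p₂ n π → head π ≡ Maybe.map (_+ 3) (head (ρ π))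
  heads π u with encode′ (proj₁ u)
  ... | v , a , b , c , k , refl
    rewrite ρ-build k | head-build {3 + v} {a} (Code.shape k) | head-build {v} {b} (Code.shape k) = cong just (+-comm 3 v)
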